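{- If $\mathbf w$ and $\mathbf u$ are reduced words of $w$ connected by braid moves, then for any $v\le w$ and any $r$, there is a bijection $\mathcal{A}^r_{v,\mathbf w}\to\mathcal{A}^r_{v,\mathbf u}$.
   Context: $v,w$ are elements of the affine Weyl group of type $\tilde A_{n-1}$, realized as the group of bijections $f:\mathbb{Z}\to\mathbb{Z}$ with $f(i+n)=f(i)+n$ and $\sum_{i=1}^n(f(i)-i)=0$, with simple generators $s_0,\dots,s_{n-1}$ ($s_i$ exchanges $i+mn$ and $i+1+mn$ for all $m$); $\le$ is Bruhat order and $\ell$ is length. A reduced word of $w$ is a sequence $\mathbf w=(s_{i_1},\dots,s_{i_m})$ with $w=s_{i_1}\cdots s_{i_m}$, $m=\ell(w)$. A braid move replaces consecutive letters $s_{i+1},s_i,s_{i+1}$ by $s_i,s_{i+1},s_i$ or vice versa (indices modulo $n$, $n\ge3$). A subword of $\mathbf w$ is $\mathbf v=(v_1,\dots,v_m)$ with $v_j\in\{s_{i_j},e\}$; it is a $v$-subword if $v_1\cdots v_m=v$; it is distinguished if $\mathbf v_{(j)}\le\mathbf v_{(j-1)}s_{i_j}$ for all $j$, where $\mathbf v_{(j)}=v_1\cdots v_j$. $\mathcal{A}^r_{v,\mathbf w}$ is the set of distinguished $v$-subwords of $\mathbf w$ with exactly $r$ entries equal to $e$. -}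

module Defs where

open import Algebra.Bundles using (Group)
open import Data.Bool.Base using (if_then_else_)
open import Data.Empty using (⊥-elim)
open import Data.Fin.Base using (Fin; toℕ; fromℕ<)
open import Data.Fin.Permutation using (Permutation′; permutation)
open import Data.Fin.Properties using (toℕ-fromℕ<; toℕ-injective; toℕ<n)
open import Data.Integer.Base using (ℤ; +_; -[1+_]; 0ℤ; 1ℤ; -1ℤ; _+_; _-_; _*_; -_; ∣_∣)
open import Data.Integer.Divisibility.Signed using (_∣_; divides; _∣?_; ∣⇒∣ᵤ)
open import Data.Integer.DivMod using (_%ℕ_; _/ℕ_; n%ℕd<d; a≡a%ℕn+[a/ℕn]*n)
import Data.Integer.Properties as ℤ
open import Data.Integer.Tactic.RingSolver using (solve-∀)
open import Data.List.Base using (List; []; _∷_; _++_; foldr; length; lookup; map; take)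
open import Data.List.Relation.Unary.All using (All; []; _∷_)
open import Data.Nat.Base as ℕ using (ℕ; zero; suc; s≤s; z≤n)
import Data.Nat.Divisibility as ℕ
open import Data.Nat.DivMod using (_mod_)
import Data.Nat.Properties as ℕ
open import Data.Product.Base using (∃; ∃₂; _×_; _,_; proj₁)
open import Function.Base using (_∘_)
open import Function.Bundles using (_↔_; Inverse; mk↔ₛ′)
open import Function.Construct.Composition using (_↔-∘_)
open import Function.Construct.Identity using (↔-id)
open import Function.Construct.Symmetry using (↔-sym)
open import Level using (0ℓ)
open import Relation.Binary.Bundles using (Setoid)
open import Relation.Binary.Construct.Closure.ReflexiveTransitive using (Star)
import Relation.Binary.Construct.On as On
open import Relation.Binary.Construct.Union using (_∪_)
open import Relation.Binary.Core using (Rel)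
open import Relation.Binary.PropositionalEquality as ≡ using (_≡_; _≗_; refl; sym; trans; cong; cong₂; subst; module ≡-Reasoning)
open import Relation.Nullary using (¬_; Dec; yes; no; does)
open import Relation.Nullary.Decidable using (dec-true; dec-false; map′)

open import Algebra.Properties.CommutativeMonoid.Sum ℤ.+-0-commutativeMonoid using (sum-syntax; sum-cong-≗; sum-replicate-zero; sum-permute; ∑-distrib-+)
open import Algebra.Properties.AbelianGroup ℤ.+-0-abelianGroup using (∙-cancelʳ)

module AffineWeyl (n : ℕ) (3≤n : 3 ℕ.≤ n) where

  instance
    n-nonZero : ℕ.NonZero n
    n-nonZero = ℕ.>-nonZero (ℕ.≤-trans (s≤s z≤n) 3≤n)

  infix 4 _≋_ _≋?_

  -- A record rather than a synonym, so that x and y can be inferred.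
  record _≋_ (x y : ℤ) : Set where
    constructor cong-mod
    field divisible : + n ∣ x - y

  _≋?_ : (x y : ℤ) → Dec (x ≋ y)
  x ≋? y = map′ cong-mod _≋_.divisible (+ n ∣? x - y)

  window : Fin n → ℤ
  window k = + suc (toℕ k)

  displacement : (ℤ → ℤ) → ℤ
  displacement f = ∑[ k < n ] (f (window k) - window k)

  module WindowSums where
    ≋-reflexive : ∀ {x y} → x ≡ y → x ≋ y
    ≋-reflexive {x} refl = cong-mod (divides 0ℤ (ℤ.+-inverseʳ x))

    ≋-sym : ∀ {x y} → x ≋ y → y ≋ x
    ≋-sym {x} {y} (cong-mod (divides q eq)) = cong-mod (divides (- q)
      (trans (lem x y) (trans (cong -_ eq) (ℤ.neg-distribˡ-* q (+ n)))))
      where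
      lem : ∀ x y → y - x ≡ - (x - y)
      lem = solve-∀

    ≋-trans : ∀ {x y z} → x ≋ y → y ≋ z → x ≋ z
    ≋-trans {x} {y} {z} (cong-mod (divides p eq)) (cong-mod (divides q eq′)) = cong-mod (divides (p + q)
      (trans (lem x y z) (trans (cong₂ _+_ eq eq′) (sym (ℤ.*-distribʳ-+ (+ n) p q)))))
      where
      lem : ∀ x y z → x - z ≡ (x - y) + (y - z)
      lem = solve-∀

    ≋-+ : ∀ {x y} c → x ≋ y → x + c ≋ y + c
    ≋-+ {x} {y} c (cong-mod d) = cong-mod (subst (+ n ∣_) (lem x y c) d)
      where
      lem : ∀ x y c → x - y ≡ (x + c) - (y + c)
      lem = solve-∀

    x+n≋x : ∀ x → x + + n ≋ x
    x+n≋x x = cong-mod (divides 1ℤ (lem x (+ n)))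
      where
      lem : ∀ x m → (x + m) - x ≡ 1ℤ * m
      lem = solve-∀

    bounded-≋⇒≡ : ∀ {a b} → a ℕ.< n → b ℕ.< n → + a ≋ + b → a ≡ b
    bounded-≋⇒≡ {a} {b} a<n b<n (cong-mod d) = ℤ.+-injective (ℤ.i-j≡0⇒i≡j (+ a) (+ b) (ℤ.∣i∣≡0⇒i≡0 (small ∣ + a - + b ∣ (∣⇒∣ᵤ d) bound)))
      where
      bound : ∣ + a - + b ∣ ℕ.< n
      bound = ℕ.≤-<-trans
        (subst (λ z → ∣ z ∣ ℕ.≤ a ℕ.⊔ b) (sym (ℤ.m-n≡m⊖n a b)) (ℤ.∣m⊝n∣≤m⊔n a b))
        (ℕ.⊔-lub a<n b<n)
      small : ∀ m → n ℕ.∣ m → m ℕ.< n → m ≡ 0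
      small zero    _ _ = refl
      small (suc m) n∣m m<n = ⊥-elim (ℕ.<⇒≱ m<n (ℕ.∣⇒≤ n∣m))

    window-injective : ∀ {j k} → window j ≋ window k → j ≡ k
    window-injective {j} {k} (cong-mod d) = toℕ-injective (bounded-≋⇒≡ (toℕ<n j) (toℕ<n k)
      (cong-mod (subst (+ n ∣_) (lem (+ toℕ j) (+ toℕ k)) d)))
      where
      lem : ∀ a b → (1ℤ + a) - (1ℤ + b) ≡ a - b
      lem = solve-∀

    residue : ℤ → Fin n
    residue x = fromℕ< (n%ℕd<d (x - 1ℤ) n)

    window-residue : ∀ x → window (residue x) ≋ x
    window-residue x = ≋-sym (cong-mod (divides ((x - 1ℤ) /ℕ n) (begin
      x - window (residue x)                     ≡⟨ cong (λ r → x - (1ℤ + + r)) (toℕ-fromℕ< (n%ℕd<d (x - 1ℤ) n)) ⟩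
      x - (1ℤ + r)                               ≡⟨ lem x r ⟩
      (x - 1ℤ) - r                               ≡⟨ cong (_- r) (a≡a%ℕn+[a/ℕn]*n (x - 1ℤ) n) ⟩
      (r + (x - 1ℤ) /ℕ n * + n) - r              ≡⟨ lem′ r ((x - 1ℤ) /ℕ n * + n) ⟩
      (x - 1ℤ) /ℕ n * + n                        ∎)))
      where
      open ≡-Reasoning
      r = + ((x - 1ℤ) %ℕ n)
      lem : ∀ x r → x - (1ℤ + r) ≡ (x - 1ℤ) - r
      lem = solve-∀
      lem′ : ∀ r y → (r + y) - r ≡ y
      lem′ = solve-∀

    shift-byℕ : ∀ (f : ℤ → ℤ) c → (∀ x → f (x + + n) ≡ f x + c) → ∀ q x → f (x + + q * + n) ≡ f x + + q * c
    shift-byℕ f c p zero x = trans (cong f (ℤ.+-identityʳ x)) (sym (ℤ.+-identityʳ (f x)))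
    shift-byℕ f c p (suc m) x = begin
      f (x + + suc m * + n)      ≡⟨ cong f (lem x (+ m) (+ n)) ⟩
      f ((x + + m * + n) + + n)  ≡⟨ p _ ⟩
      f (x + + m * + n) + c      ≡⟨ cong (_+ c) (shift-byℕ f c p m x) ⟩
      (f x + + m * c) + c        ≡⟨ lem (f x) (+ m) c ⟨
      f x + + suc m * c          ∎
      where
      open ≡-Reasoning
      lem : ∀ x q k → x + (1ℤ + q) * k ≡ (x + q * k) + k
      lem = solve-∀

    shift-by : ∀ (f : ℤ → ℤ) c → (∀ x → f (x + + n) ≡ f x + c) → ∀ q x → f (x + q * + n) ≡ f x + q * c
    shift-by f c p (+ m) x = shift-byℕ f c p m x
    shift-by f c p -[1+ m ] x = begin
      f y                        ≡⟨ lem (f y) (+ suc m) c ⟩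
      (f y + + suc m * c) - + suc m * c  ≡⟨ cong (_- + suc m * c) (shift-byℕ f c p (suc m) y) ⟨
      f (y + + suc m * + n) - + suc m * c  ≡⟨ cong (λ z → f z - + suc m * c) (lem′ x (+ suc m) (+ n)) ⟩
      f x - + suc m * c          ≡⟨ cong (_+_ (f x)) (ℤ.neg-distribˡ-* (+ suc m) c) ⟩
      f x + -[1+ m ] * c         ∎
      where
      open ≡-Reasoning
      y = x + -[1+ m ] * + n
      lem : ∀ a q k → a ≡ (a + q * k) - q * k
      lem = solve-∀
      lem′ : ∀ x q k → (x + (- q) * k) + q * k ≡ x
      lem′ = solve-∀

    split : ∀ {x y} (d : x ≋ y) → x ≡ y + _∣_.quotient (_≋_.divisible d) * + n
    split {x} {y} (cong-mod (divides q eq)) = trans (lem x y) (cong (_+_ y) eq)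
      where
      lem : ∀ x y → x ≡ y + (x - y)
      lem = solve-∀

    Periodic : (ℤ → ℤ) → Set
    Periodic f = ∀ x → f (x + + n) ≡ f x + + n

    periodic-≋ : ∀ f → Periodic f → ∀ {x y} → x ≋ y → f x ≋ f y
    periodic-≋ f p {x} {y} d@(cong-mod (divides q _)) = cong-mod (divides q
      (trans (cong (_- f y) (trans (cong f (split d)) (shift-by f (+ n) p q y))) (lem (f y) (q * + n))))
      where
      lem : ∀ a b → (a + b) - a ≡ b
      lem = solve-∀

    invariant-≋ : ∀ {h : ℤ → ℤ} → (∀ x → h (x + + n) ≡ h x) → ∀ {x y} → x ≋ y → h x ≡ h y
    invariant-≋ {h} p {x} {y} d@(cong-mod (divides q _)) = trans (cong h (split d))
      (trans (shift-by h 0ℤ (λ z → trans (p z) (sym (ℤ.+-identityʳ (h z)))) q y)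
             (trans (cong (_+_ (h y)) (ℤ.*-zeroʳ q)) (ℤ.+-identityʳ (h y))))

    inverse-periodic : (g : ℤ ↔ ℤ) → Periodic (Inverse.to g) → Periodic (Inverse.from g)
    inverse-periodic g p x = begin
      from (x + + n)              ≡⟨ cong (λ z → from (z + + n)) (Inverse.strictlyInverseˡ g x) ⟨
      from (to (from x) + + n)    ≡⟨ cong from (p (from x)) ⟨
      from (to (from x + + n))    ≡⟨ Inverse.strictlyInverseʳ g _ ⟩
      from x + + n                ∎
      where
      open ≡-Reasoning
      open Inverse g

    residuePermutation : (g : ℤ ↔ ℤ) → Periodic (Inverse.to g) → Permutation′ n
    residuePermutation g p = permutation
      (residue ∘ to ∘ window) (residue ∘ from ∘ window)
      (λ k → window-injective (≋-trans (window-residue _) (≋-trans (periodic-≋ to p (window-residue _)) (≋-reflexive (Inverse.strictlyInverseˡ g _)))))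
      (λ k → window-injective (≋-trans (window-residue _) (≋-trans (periodic-≋ from (inverse-periodic g p) (window-residue _)) (≋-reflexive (Inverse.strictlyInverseʳ g _)))))
      where open Inverse g

    sum-reindex : ∀ {h : ℤ → ℤ} → (∀ x → h (x + + n) ≡ h x) → (g : ℤ ↔ ℤ) → Periodic (Inverse.to g) →
                  ∑[ k < n ] h (Inverse.to g (window k)) ≡ ∑[ k < n ] h (window k)
    sum-reindex {h} hp g p = trans
      (sum-cong-≗ (λ k → sym (invariant-≋ hp (window-residue (Inverse.to g (window k))))))
      (sym (sum-permute (h ∘ window) (residuePermutation g p)))

    displacement-∘ : ∀ f → Periodic f → (g : ℤ ↔ ℤ) → Periodic (Inverse.to g) →
                     displacement (f ∘ Inverse.to g) ≡ displacement f + displacement (Inverse.to g)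
    displacement-∘ f fp g gp = begin
      displacement (f ∘ to)
        ≡⟨ sum-cong-≗ (λ k → lem (f (to (window k))) (to (window k)) (window k)) ⟩
      ∑[ k < n ] (h (to (window k)) + (to (window k) - window k))
        ≡⟨ ∑-distrib-+ (h ∘ to ∘ window) (λ k → to (window k) - window k) ⟩
      ∑[ k < n ] h (to (window k)) + displacement to
        ≡⟨ cong (_+ displacement to) (sum-reindex h-invariant g gp) ⟩
      displacement f + displacement to ∎
      where
      open ≡-Reasoning
      open Inverse g using (to)
      h : ℤ → ℤ
      h x = f x - x
      lem : ∀ a b c → a - c ≡ (a - b) + (b - c)
      lem = solve-∀
      lem′ : ∀ a b c → (a + c) - (b + c) ≡ a - b
      lem′ = solve-∀
      h-invariant : ∀ x → h (x + + n) ≡ h x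
      h-invariant x = trans (cong (_- (x + + n)) (fp x)) (lem′ (f x) x (+ n))

    displacement-cong : ∀ {f g} → f ≗ g → displacement f ≡ displacement g
    displacement-cong eq = sum-cong-≗ (λ k → cong (_- window k) (eq (window k)))

    displacement-id : displacement (λ x → x) ≡ 0ℤ
    displacement-id = trans (sum-cong-≗ (λ k → ℤ.+-inverseʳ (window k))) (sum-replicate-zero n)

  open WindowSums

  record W : Set where
    field
      perm     : ℤ ↔ ℤ
    open Inverse perm public using (to; from)
    field
      periodic : ∀ x → to (x + + n) ≡ to x + + n
      balanced : ∑[ k < n ] (to (window k) - window k) ≡ 0ℤ

  open W public using (to)

  infix  4 _≈_
  infixl 7 _∙_
  infix  8 _⁻¹

  _≈_ : Rel W 0ℓ
  f ≈ g = to f ≗ to g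

  ε : W
  ε = record { perm = ↔-id ℤ ; periodic = λ _ → refl ; balanced = displacement-id }

  _∙_ : W → W → W
  f ∙ g = record
    { perm     = W.perm f ↔-∘ W.perm g
    ; periodic = λ x → trans (cong (to f) (W.periodic g x)) (W.periodic f (to g x))
    ; balanced = trans (displacement-∘ (to f) (W.periodic f) (W.perm g) (W.periodic g))
                       (cong₂ _+_ (W.balanced f) (W.balanced g))
    }

  _⁻¹ : W → W
  f ⁻¹ = record
    { perm     = ↔-sym (W.perm f)
    ; periodic = from-periodic
    ; balanced = begin
        displacement (W.from f)                         ≡⟨ ℤ.+-identityʳ _ ⟨
        displacement (W.from f) + 0ℤ                    ≡⟨ cong (_+_ (displacement (W.from f))) (W.balanced f) ⟨
        displacement (W.from f) + displacement (to f)   ≡⟨ displacement-∘ (W.from f) from-periodic (W.perm f) (W.periodic f) ⟨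
        displacement (W.from f ∘ to f)                  ≡⟨ displacement-cong (Inverse.strictlyInverseʳ (W.perm f)) ⟩
        displacement (λ x → x)                          ≡⟨ displacement-id ⟩
        0ℤ                                              ∎
    }
    where
    open ≡-Reasoning
    from-periodic = inverse-periodic (W.perm f) (W.periodic f)

  group : Group 0ℓ 0ℓ
  group = record
    { Carrier = W ; _≈_ = _≈_ ; _∙_ = _∙_ ; ε = ε ; _⁻¹ = _⁻¹
    ; isGroup = record
      { isMonoid = record
        { isSemigroup = record
          { isMagma = record
            { isEquivalence = record
              { refl  = λ _ → refl
              ; sym   = λ p x → sym (p x)
              ; trans = λ p q x → trans (p x) (q x)
              }
            ; ∙-cong = λ {f} {g} {h} {k} p q x → trans (cong (to f) (q x)) (p (to k x))
            }
          ; assoc = λ _ _ _ _ → refl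
          }
        ; identity = (λ _ _ → refl) , (λ _ _ → refl)
        }
      ; inverse = (λ f → Inverse.strictlyInverseʳ (W.perm f)) , (λ f → Inverse.strictlyInverseˡ (W.perm f))
      ; ⁻¹-cong = λ {f} {g} p x → trans
          (cong (W.from f) (trans (sym (Inverse.strictlyInverseˡ (W.perm g) x)) (sym (p (W.from g x)))))
          (Inverse.strictlyInverseʳ (W.perm f) (W.from g x))
      }
    }

  swap : Fin n → ℤ → ℤ
  swap i x =
    if does (x ≋? + toℕ i) then x + 1ℤ
    else if does (x ≋? + suc (toℕ i)) then x - 1ℤ
    else x

  module SwapProperties where
    a≋̸1+a : ∀ a → ¬ (a ≋ 1ℤ + a)
    a≋̸1+a a d = absurd (bounded-≋⇒≡ {1} {0} (ℕ.≤-trans (s≤s (s≤s z≤n)) 3≤n) (ℕ.≤-trans (s≤s z≤n) 3≤n) (cong-mod (subst (+ n ∣_) (lem a) (_≋_.divisible (≋-sym d)))))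
      where
      lem : ∀ a → (1ℤ + a) - a ≡ 1ℤ - 0ℤ
      lem = solve-∀
      absurd : ¬ (1 ≡ 0)
      absurd ()

    +1-1 : ∀ x → (x + 1ℤ) - 1ℤ ≡ x
    +1-1 = solve-∀

    -1+1 : ∀ x → (x - 1ℤ) + 1ℤ ≡ x
    -1+1 = solve-∀

    suc-≋ : ∀ {x} a → x ≋ a → x + 1ℤ ≋ 1ℤ + a
    suc-≋ a d = subst (_ ≋_) (ℤ.+-comm a 1ℤ) (≋-+ 1ℤ d)

    pred-≋ : ∀ {x} a → x ≋ 1ℤ + a → x - 1ℤ ≋ a
    pred-≋ a d = subst (_ ≋_) (lem a) (≋-+ -1ℤ d)
      where
      lem : ∀ a → (1ℤ + a) - 1ℤ ≡ a
      lem = solve-∀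

    swap-low : ∀ i {x} → x ≋ + toℕ i → swap i x ≡ x + 1ℤ
    swap-low i {x} d rewrite dec-true (x ≋? + toℕ i) d = refl

    swap-high : ∀ i {x} → x ≋ + suc (toℕ i) → swap i x ≡ x - 1ℤ
    swap-high i {x} d
      rewrite dec-false (x ≋? + toℕ i) (λ e → a≋̸1+a (+ toℕ i) (≋-trans (≋-sym e) d))
            | dec-true (x ≋? + suc (toℕ i)) d = refl

    swap-fixed : ∀ i {x} → ¬ (x ≋ + toℕ i) → ¬ (x ≋ + suc (toℕ i)) → swap i x ≡ x
    swap-fixed i {x} ¬d ¬e
      rewrite dec-false (x ≋? + toℕ i) ¬d | dec-false (x ≋? + suc (toℕ i)) ¬e = refl

    swap-involutive : ∀ i x → swap i (swap i x) ≡ x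
    swap-involutive i x = go (x ≋? + toℕ i) (x ≋? + suc (toℕ i))
      where
      go : Dec (x ≋ + toℕ i) → Dec (x ≋ + suc (toℕ i)) → swap i (swap i x) ≡ x
      go (yes d) _ = trans (cong (swap i) (swap-low i d)) (trans (swap-high i (suc-≋ (+ toℕ i) d)) (+1-1 x))
      go (no _) (yes e) = trans (cong (swap i) (swap-high i e)) (trans (swap-low i (pred-≋ (+ toℕ i) e)) (-1+1 x))
      go (no ¬d) (no ¬e) = trans (cong (swap i) (swap-fixed i ¬d ¬e)) (swap-fixed i ¬d ¬e)

    swap-periodic : ∀ i x → swap i (x + + n) ≡ swap i x + + n
    swap-periodic i x = go (x ≋? + toℕ i) (x ≋? + suc (toℕ i))
      where
      comm : ∀ x m c → (x + m) + c ≡ (x + c) + m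
      comm = solve-∀
      up : ∀ {a} → x ≋ a → x + + n ≋ a
      up = ≋-trans (x+n≋x x)
      down : ∀ {a} → x + + n ≋ a → x ≋ a
      down = ≋-trans (≋-sym (x+n≋x x))
      go : Dec (x ≋ + toℕ i) → Dec (x ≋ + suc (toℕ i)) → swap i (x + + n) ≡ swap i x + + n
      go (yes d) _ = trans (swap-low i (up d)) (trans (comm x (+ n) 1ℤ) (cong (_+ + n) (sym (swap-low i d))))
      go (no _) (yes e) = trans (swap-high i (up e)) (trans (comm x (+ n) -1ℤ) (cong (_+ + n) (sym (swap-high i e))))
      go (no ¬d) (no ¬e) = trans (swap-fixed i (¬d ∘ down) (¬e ∘ down)) (cong (_+ + n) (sym (swap-fixed i ¬d ¬e)))

    indicator : Fin n → ℤ → ℤ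
    indicator i x = if does (x ≋? + toℕ i) then 1ℤ else 0ℤ

    indicator-yes : ∀ i {x} → x ≋ + toℕ i → indicator i x ≡ 1ℤ
    indicator-yes i {x} d rewrite dec-true (x ≋? + toℕ i) d = refl

    indicator-no : ∀ i {x} → ¬ (x ≋ + toℕ i) → indicator i x ≡ 0ℤ
    indicator-no i {x} ¬d rewrite dec-false (x ≋? + toℕ i) ¬d = refl

    indicator-invariant : ∀ i x → indicator i (x + + n) ≡ indicator i x
    indicator-invariant i x = go (x ≋? + toℕ i)
      where
      go : Dec (x ≋ + toℕ i) → indicator i (x + + n) ≡ indicator i x
      go (yes d) = trans (indicator-yes i (≋-trans (x+n≋x x) d)) (sym (indicator-yes i d))
      go (no ¬d) = trans (indicator-no i (¬d ∘ ≋-trans (≋-sym (x+n≋x x)))) (sym (indicator-no i ¬d))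

    swap-displacement : ∀ i x → indicator i x ≡ (swap i x - x) + indicator i (x - 1ℤ)
    swap-displacement i x = go (x ≋? + toℕ i) (x ≋? + suc (toℕ i))
      where
      a = + toℕ i
      restore : ∀ {x} → x - 1ℤ ≋ a → x ≋ + suc (toℕ i)
      restore {x} d = subst (_≋ _) (-1+1 x) (suc-≋ a d)
      l₁ : ∀ x → 1ℤ ≡ ((x + 1ℤ) - x) + 0ℤ
      l₁ = solve-∀
      l₂ : ∀ x → 0ℤ ≡ ((x - 1ℤ) - x) + 1ℤ
      l₂ = solve-∀
      l₃ : ∀ x → 0ℤ ≡ (x - x) + 0ℤ
      l₃ = solve-∀
      go : Dec (x ≋ a) → Dec (x ≋ + suc (toℕ i)) → indicator i x ≡ (swap i x - x) + indicator i (x - 1ℤ)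
      combine : ∀ {p q r p′ q′ r′} → p ≡ p′ → q ≡ q′ → r ≡ r′ → p′ ≡ (q′ - x) + r′ → p ≡ (q - x) + r
      combine refl refl refl eq = eq
      go (yes d) _ = combine (indicator-yes i d) (swap-low i d)
        (indicator-no i (λ e → a≋̸1+a a (≋-trans (≋-sym d) (restore e)))) (l₁ x)
      go (no ¬d) (yes e) = combine (indicator-no i ¬d) (swap-high i e) (indicator-yes i (pred-≋ a e)) (l₂ x)
      go (no ¬d) (no ¬e) = combine (indicator-no i ¬d) (swap-fixed i ¬d ¬e) (indicator-no i (¬e ∘ restore)) (l₃ x)

    swap-balanced : ∀ i → displacement (swap i) ≡ 0ℤ
    swap-balanced i = ∙-cancelʳ A _ _ (begin
      displacement (swap i) + A
        ≡⟨ cong (_+_ (displacement (swap i))) (sum-reindex (indicator-invariant i) pred↔ (λ x → pred-periodic x (+ n))) ⟨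
      displacement (swap i) + ∑[ k < n ] indicator i (window k - 1ℤ)
        ≡⟨ ∑-distrib-+ (λ k → swap i (window k) - window k) (λ k → indicator i (window k - 1ℤ)) ⟨
      ∑[ k < n ] ((swap i (window k) - window k) + indicator i (window k - 1ℤ))
        ≡⟨ sum-cong-≗ (λ k → swap-displacement i (window k)) ⟨
      A ≡⟨ ℤ.+-identityˡ A ⟨
      0ℤ + A ∎)
      where
      open ≡-Reasoning
      A = ∑[ k < n ] indicator i (window k)
      pred↔ : ℤ ↔ ℤ
      pred↔ = mk↔ₛ′ (_- 1ℤ) (_+ 1ℤ) +1-1 -1+1
      pred-periodic : ∀ x m → (x + m) - 1ℤ ≡ (x - 1ℤ) + m
      pred-periodic = solve-∀

  open SwapProperties

  s : Fin n → W
  s i = record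
    { perm     = mk↔ₛ′ (swap i) (swap i) (swap-involutive i) (swap-involutive i)
    ; periodic = swap-periodic i
    ; balanced = swap-balanced i
    }

  next : Fin n → Fin n
  next i = suc (toℕ i) mod n

  Word : Set
  Word = List (Fin n)

  product : List W → W
  product = foldr _∙_ ε

  ⟦_⟧ : Word → W
  ⟦ 𝐰 ⟧ = product (map s 𝐰)

  -- HasLength w m says ℓ(w) = m.
  HasLength : W → ℕ → Set
  HasLength w m =
    (∃ λ (𝐰 : Word) → ⟦ 𝐰 ⟧ ≈ w × length 𝐰 ≡ m) ×
    (∀ (𝐰 : Word) → ⟦ 𝐰 ⟧ ≈ w → m ℕ.≤ length 𝐰)

  ReducedWord : W → Word → Set
  ReducedWord w 𝐰 = ⟦ 𝐰 ⟧ ≈ w × HasLength w (length 𝐰)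

  Reflection : W → Set
  Reflection t = ∃₂ λ (g : W) (i : Fin n) → t ≈ g ∙ s i ∙ g ⁻¹

  infix 4 _ℓ<_ _⟶_ _≤_

  _ℓ<_ : Rel W 0ℓ
  u ℓ< w = ∃₂ λ a b → HasLength u a × HasLength w b × a ℕ.< b

  _⟶_ : Rel W 0ℓ
  u ⟶ w = ∃ λ t → Reflection t × w ≈ u ∙ t × u ℓ< w

  -- Bruhat order; _≈_ is included because elements of W are compared
  -- pointwise rather than propositionally.
  _≤_ : Rel W 0ℓ
  _≤_ = Star (_≈_ ∪ _⟶_)

  data BraidMove : Rel Word 0ℓ where
    lower : ∀ 𝐩 i 𝐪 → BraidMove (𝐩 ++ next i ∷ i ∷ next i ∷ 𝐪) (𝐩 ++ i ∷ next i ∷ i ∷ 𝐪)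
    raise : ∀ 𝐩 i 𝐪 → BraidMove (𝐩 ++ i ∷ next i ∷ i ∷ 𝐪) (𝐩 ++ next i ∷ i ∷ next i ∷ 𝐪)

  BraidConnected : Rel Word 0ℓ
  BraidConnected = Star BraidMove

  data Entry (i : Fin n) : Set where
    gen  : Entry i
    unit : Entry i

  Subword : Word → Set
  Subword = All Entry

  entryValue : ∀ {i} → Entry i → W
  entryValue {i} gen  = s i
  entryValue     unit = ε

  values : ∀ {𝐰} → Subword 𝐰 → List W
  values []       = []
  values (v ∷ 𝐯) = entryValue v ∷ values 𝐯

  units : ∀ {𝐰} → Subword 𝐰 → ℕ
  units []           = 0
  units (gen  ∷ 𝐯) = units 𝐯
  units (unit ∷ 𝐯) = suc (units 𝐯)

  prefix : ∀ {𝐰} → Subword 𝐰 → ℕ → W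
  prefix 𝐯 j = product (take j (values 𝐯))

  IsSubwordFor : W → ∀ {𝐰} → Subword 𝐰 → Set
  IsSubwordFor v 𝐯 = product (values 𝐯) ≈ v

  -- The index j : Fin (length 𝐰) is zero-based.
  Distinguished : ∀ {𝐰} → Subword 𝐰 → Set
  Distinguished {𝐰} 𝐯 = (j : Fin (length 𝐰)) →
    prefix 𝐯 (suc (toℕ j)) ≤ prefix 𝐯 (toℕ j) ∙ s (lookup 𝐰 j)

  -- As a set of subwords: two elements are equal when the underlying
  -- subwords are, whatever the membership proofs.
  𝒜 : ℕ → W → Word → Setoid 0ℓ 0ℓ
  𝒜 r v 𝐰 = On.setoid (≡.setoid (Subword 𝐰))
    (proj₁ {B = λ 𝐯 → IsSubwordFor v 𝐯 × Distinguished 𝐯 × units 𝐯 ≡ r})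

{-# OPTIONS --safe #-}

-- For a generator sᵢ one has x ≤ x sᵢ exactly when x(i) < x(i+1): if
-- x(i) > x(i+1), follow the pair (i, i+1) through a word of x; some letter
-- first reverses it, and deleting this letter gives a word of x sᵢ.  Hence
-- ℓ(x sᵢ) = ℓ(x) ± 1 with the sign read off from x.  A subword is therefore
-- distinguished when e is only used at ascents.  For the three letters touched by
-- a braid move, this condition depends only on the relative order of x(i), x(i+1),
-- x(i+2), where x is the product of the entries before them, and the choices
-- for s_a s_b s_a and s_b s_a s_b with equal product and equal number of e's
-- can be matched explicitly.
module Submission where

open import Defs
open import Data.Fin.Base using (Fin; zero; suc; toℕ)
open import Data.Fin.Properties using (toℕ-fromℕ<)
open import Data.Integer.Base as ℤ using (ℤ; +_; 1ℤ; _+_; _-_; -_; _*_; _<_; +<+)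
open import Data.Integer.Divisibility.Signed using (_∣_; divides)
import Data.Integer.Properties as ℤ
open import Data.Integer.Tactic.RingSolver using (solve-∀)
open import Data.List.Base using ([]; _∷_; _++_; _∷ʳ_; length; lookup)
open import Data.List.Properties using (length-++)
open import Data.List.Relation.Unary.All using ([]; _∷_)
open import Data.Nat.Base as ℕ using (ℕ; suc; s≤s; z≤n) renaming (_≤_ to _≤ℕ_)
open import Data.Nat.DivMod using (_/_; m≡m%n+[m/n]*n; m%n<n)
import Data.Nat.Properties as ℕ
open import Data.Product.Base using (∃; _×_; _,_; proj₁; proj₂)
open import Data.Sum.Base using (_⊎_; inj₁; inj₂)
open import Data.Unit.Base using (⊤; tt)
open import Function.Base using (_∘_)
open import Function.Bundles using (Bijection; Inverse)
open import Function.Construct.Composition using (inverse)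
open import Function.Construct.Identity using () renaming (inverse to inverse-id)
open import Function.Properties.Inverse using (Inverse⇒Bijection)
open import Relation.Binary.Bundles using (Setoid)
open import Relation.Binary.Construct.Closure.ReflexiveTransitive using (ε; _◅_; _◅◅_)
open import Relation.Binary.Definitions using (tri<; tri≈; tri>)
open import Relation.Binary.PropositionalEquality using (_≡_; _≗_; refl; sym; trans; cong; subst; subst₂)
open import Relation.Nullary using (¬_; Dec; yes; no; contradiction)

module _ (n : ℕ) (3≤n : 3 ≤ℕ n) where

  open AffineWeyl n 3≤n renaming (ε to e)
  open WindowSums
  open SwapProperties

  -- Values of affine permutations and their ascents

  shift : ∀ (x : W) {c d} (c≋d : c ≋ d) → to x c ≡ to x d + _∣_.quotient (_≋_.divisible c≋d) * + n
  shift x {d = d} c≋d = trans (cong (to x) (split c≋d)) (shift-by (to x) (+ n) (W.periodic x) (_∣_.quotient (_≋_.divisible c≋d)) d)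

  agree-≋ : ∀ (x y : W) {c z} → to x c ≡ to y c → z ≋ c → to x z ≡ to y z
  agree-≋ x y eq z≋c = trans (shift x z≋c) (trans (cong (_+ _) eq) (sym (shift y z≋c)))

  -- Shifting both positions by the same multiple of n adds the same amount to both values. This is
  -- needed because `next` wraps around modulo n.
  consecutive-<-≋ : ∀ (x : W) {c d} → c ≋ d → to x d < to x (1ℤ + d) → to x c < to x (1ℤ + c)
  consecutive-<-≋ x {c} {d} c≋d lt = subst₂ _<_ (sym (shift x c≋d)) (sym shift-suc) (ℤ.+-monoˡ-< (q * + n) lt)
    where
    q = _∣_.quotient (_≋_.divisible c≋d)
    shift-suc : to x (1ℤ + c) ≡ to x (1ℤ + d) + q * + n
    shift-suc = trans (cong (to x) (trans (cong (_+_ 1ℤ) (split c≋d)) (sym (ℤ.+-assoc 1ℤ d (q * + n)))))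
                      (shift-by (to x) (+ n) (W.periodic x) q (1ℤ + d))

  to-injective : ∀ (x : W) {c d} → to x c ≡ to x d → c ≡ d
  to-injective x {c} {d} eq = trans (sym (Inverse.strictlyInverseʳ (W.perm x) c))
    (trans (cong (W.from x) eq) (Inverse.strictlyInverseʳ (W.perm x) d))

  to-≋-injective : ∀ (x : W) {c d} → to x c ≋ to x d → c ≋ d
  to-≋-injective x {c} {d} eq = subst₂ _≋_ (Inverse.strictlyInverseʳ (W.perm x) c) (Inverse.strictlyInverseʳ (W.perm x) d)
    (periodic-≋ (W.from x) (W.periodic (x ⁻¹)) eq)

  ≋-suc : ∀ {c d} → c ≋ d → 1ℤ + c ≋ 1ℤ + d
  ≋-suc {c} {d} eq = subst₂ _≋_ (ℤ.+-comm c 1ℤ) (ℤ.+-comm d 1ℤ) (≋-+ 1ℤ eq)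

  swap-bottom : ∀ i → swap i (+ toℕ i) ≡ + suc (toℕ i)
  swap-bottom i = trans (swap-low i (≋-reflexive refl)) (ℤ.+-comm (+ toℕ i) 1ℤ)

  swap-top : ∀ i → swap i (+ suc (toℕ i)) ≡ + toℕ i
  swap-top i = trans (cong (swap i) (sym (swap-bottom i))) (swap-involutive i _)

  Ascent : W → Fin n → Set
  Ascent x i = to x (+ toℕ i) < to x (+ suc (toℕ i))

  Descent : W → Fin n → Set
  Descent x i = to x (+ suc (toℕ i)) < to x (+ toℕ i)

  ascent⊎descent : ∀ x i → Ascent x i ⊎ Descent x i
  ascent⊎descent x i with ℤ.<-cmp (to x (+ toℕ i)) (to x (+ suc (toℕ i)))
  ... | tri< lt _ _ = inj₁ lt
  ... | tri> _ _ gt = inj₂ gt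
  ... | tri≈ _ eq _ = contradiction (≋-reflexive (to-injective x eq)) (a≋̸1+a (+ toℕ i))

  ascent? : ∀ x i → Dec (Ascent x i)
  ascent? x i = to x (+ toℕ i) ℤ.<? to x (+ suc (toℕ i))

  descent-resp-≈ : ∀ {x y} i → x ≈ y → Descent x i → Descent y i
  descent-resp-≈ i x≈y = subst₂ _<_ (x≈y _) (x≈y _)

  ascent⇒descent-∙s : ∀ x i → Ascent x i → Descent (x ∙ s i) i
  ascent⇒descent-∙s x i = subst₂ _<_ (cong (to x) (sym (swap-top i))) (cong (to x) (sym (swap-bottom i)))

  descent⇒ascent-∙s : ∀ x i → Descent x i → Ascent (x ∙ s i) i
  descent⇒ascent-∙s x i = subst₂ _<_ (cong (to x) (sym (swap-bottom i))) (cong (to x) (sym (swap-top i)))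

  ascent-∙s⇒descent : ∀ x i → Ascent (x ∙ s i) i → Descent x i
  ascent-∙s⇒descent x i = subst₂ _<_ (cong (to x) (swap-bottom i)) (cong (to x) (swap-top i))

  -- Length

  pred≤swap : ∀ k c → c - 1ℤ ℤ.≤ swap k c
  pred≤swap k c = go (c ≋? + toℕ k) (c ≋? + suc (toℕ k))
    where
    c-1≤c : c - 1ℤ ℤ.≤ c
    c-1≤c = ℤ.i-j≤i c 1ℤ
    go : Dec (c ≋ + toℕ k) → Dec (c ≋ + suc (toℕ k)) → c - 1ℤ ℤ.≤ swap k c
    go (yes d) _       = subst (c - 1ℤ ℤ.≤_) (sym (swap-low k d)) (ℤ.≤-trans c-1≤c (ℤ.i≤i+j c 1ℤ))
    go (no _)  (yes d) = ℤ.≤-reflexive (sym (swap-high k d))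
    go (no ¬d) (no ¬e) = subst (c - 1ℤ ℤ.≤_) (sym (swap-fixed k ¬d ¬e)) c-1≤c

  -- A swap lowers an integer by at most one, so d ≤ `swap k d` + 1 ≤ `swap k c`, and hence c <
  -- `swap k c`. Only integers congruent to `toℕ k` are raised, and only by one, which leaves d = c
  -- + 1.
  swap-reverses : ∀ k {c d} → c < d → swap k d < swap k c → c ≋ + toℕ k × d ≡ c + 1ℤ
  swap-reverses k {c} {d} c<d sd<sc = go (c ≋? + toℕ k) (c ≋? + suc (toℕ k))
    where
    d≤swap+1 : d ℤ.≤ swap k d + 1ℤ
    d≤swap+1 = subst (ℤ._≤ swap k d + 1ℤ) (-1+1 d) (ℤ.+-monoˡ-≤ 1ℤ (pred≤swap k d))
    d≤swap-c : d ℤ.≤ swap k c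
    d≤swap-c = ℤ.≤-trans d≤swap+1 (subst (ℤ._≤ swap k c) (ℤ.+-comm 1ℤ (swap k d)) (ℤ.i<j⇒suc[i]≤j sd<sc))
    c<swap-c : c < swap k c
    c<swap-c = ℤ.<-≤-trans c<d d≤swap-c
    go : Dec (c ≋ + toℕ k) → Dec (c ≋ + suc (toℕ k)) → c ≋ + toℕ k × d ≡ c + 1ℤ
    go (yes l) _       = l , ℤ.≤-antisym (subst (d ℤ.≤_) (swap-low k l) d≤swap-c)
                                         (subst (ℤ._≤ d) (ℤ.+-comm 1ℤ c) (ℤ.i<j⇒suc[i]≤j c<d))
    go (no _)  (yes h) = contradiction (ℤ.<-≤-trans (subst (c <_) (swap-high k h) c<swap-c) (ℤ.i-j≤i c 1ℤ)) (ℤ.<-irrefl refl)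
    go (no ¬l) (no ¬h) = contradiction (subst (c <_) (swap-fixed k ¬l ¬h) c<swap-c) (ℤ.<-irrefl refl)

  -- Conjugating `s i` by `x` gives the reflection exchanging x(i) and x(i+1); under the hypotheses
  -- this is `s k`.
  conjugate-simple : ∀ k (x : W) i → to x (+ toℕ i) ≋ + toℕ k → to x (+ suc (toℕ i)) ≡ to x (+ toℕ i) + 1ℤ →
                     s k ∙ x ∙ s i ≈ x
  conjugate-simple k x i xi≋k x[i+1] z = go (z ≋? + toℕ i) (z ≋? + suc (toℕ i))
    where
    low : z ≋ + toℕ i → to (s k ∙ x ∙ s i) z ≡ to x z
    low = agree-≋ (s k ∙ x ∙ s i) x (trans (cong (swap k ∘ to x) (swap-bottom i))
      (trans (cong (swap k) x[i+1]) (trans (swap-high k (suc-≋ _ xi≋k)) (+1-1 _))))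
    high : z ≋ + suc (toℕ i) → to (s k ∙ x ∙ s i) z ≡ to x z
    high = agree-≋ (s k ∙ x ∙ s i) x (trans (cong (swap k ∘ to x) (swap-top i))
      (trans (swap-low k xi≋k) (sym x[i+1])))
    go : Dec (z ≋ + toℕ i) → Dec (z ≋ + suc (toℕ i)) → to (s k ∙ x ∙ s i) z ≡ to x z
    go (yes l) _       = low l
    go (no _)  (yes h) = high h
    go (no ¬l) (no ¬h) = trans (cong (swap k ∘ to x) (swap-fixed i ¬l ¬h))
      -- Since `x` is injective on residue classes, no other class is sent to those moved by `s k`.
      (swap-fixed k (λ d → ¬l (to-≋-injective x (≋-trans d (≋-sym xi≋k))))
                    (λ d → ¬h (to-≋-injective x (≋-trans d (≋-sym (subst (_≋ _) (sym x[i+1]) (suc-≋ _ xi≋k)))))))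

  -- The exchange condition. Letters act from the right end, so a descent either already occurs in
  -- the tail or is created by the head.
  exchange : ∀ 𝐰 i → Descent ⟦ 𝐰 ⟧ i → ∃ λ 𝐯 → ⟦ 𝐯 ⟧ ≈ ⟦ 𝐰 ⟧ ∙ s i × length 𝐰 ≡ suc (length 𝐯)
  exchange [] i (+<+ lt) = contradiction lt (ℕ.<-asym (ℕ.n<1+n (toℕ i)))
  exchange (k ∷ 𝐮) i desc with ascent⊎descent ⟦ 𝐮 ⟧ i
  -- Here `k` reverses the pair, so `s k ∙ ⟦ 𝐮 ⟧ ∙ s i ≈ ⟦ 𝐮 ⟧` and `k` is the letter to delete.
  ... | inj₁ asc = 𝐮 , (λ z → sym (conjugate-simple k ⟦ 𝐮 ⟧ i (proj₁ rev) (proj₂ rev) z)) , refl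
    where rev = swap-reverses k asc desc
  ... | inj₂ desc′ with exchange 𝐮 i desc′
  ...   | 𝐯 , eq , len = k ∷ 𝐯 , (λ z → cong (swap k) (eq z)) , cong suc len

  ⟦∷ʳ⟧ : ∀ 𝐰 i → ⟦ 𝐰 ∷ʳ i ⟧ ≈ ⟦ 𝐰 ⟧ ∙ s i
  ⟦∷ʳ⟧ []      i z = refl
  ⟦∷ʳ⟧ (k ∷ 𝐰) i z = cong (swap k) (⟦∷ʳ⟧ 𝐰 i z)

  length-∷ʳ : ∀ (𝐰 : Word) i → length (𝐰 ∷ʳ i) ≡ suc (length 𝐰)
  length-∷ʳ 𝐰 i = trans (length-++ 𝐰) (ℕ.+-comm (length 𝐰) 1)

  length-resp-≈ : ∀ {x y a} → x ≈ y → HasLength x a → HasLength y a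
  length-resp-≈ x≈y ((𝐰 , eq , len) , min) =
    (𝐰 , (λ z → trans (eq z) (x≈y z)) , len) , (λ 𝐯 eq′ → min 𝐯 (λ z → trans (eq′ z) (sym (x≈y z))))

  length-unique : ∀ {x a b} → HasLength x a → HasLength x b → a ≡ b
  length-unique ((𝐰 , eq , refl) , min) ((𝐰′ , eq′ , refl) , min′) = ℕ.≤-antisym (min 𝐰′ eq′) (min′ 𝐰 eq)

  length-e : HasLength e 0
  length-e = ([] , (λ _ → refl) , refl) , (λ _ _ → z≤n)

  -- Appending `i` gives the upper bound. For the lower bound, any word of `x ∙ s i` has a descent
  -- at `i`, and `exchange` shortens it to a word of `x`.
  length-ascent : ∀ {x a} i → HasLength x a → Ascent x i → HasLength (x ∙ s i) (suc a)
  length-ascent {x} {a} i ((𝐰 , eq , len) , min) asc =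
    (𝐰 ∷ʳ i , (λ z → trans (⟦∷ʳ⟧ 𝐰 i z) (eq _)) , trans (length-∷ʳ 𝐰 i) (cong suc len)) , longer
    where
    longer : ∀ 𝐯 → ⟦ 𝐯 ⟧ ≈ x ∙ s i → suc a ≤ℕ length 𝐯
    longer 𝐯 eq′ with exchange 𝐯 i (descent-resp-≈ {x ∙ s i} {⟦ 𝐯 ⟧} i (λ z → sym (eq′ z)) (ascent⇒descent-∙s x i asc))
    ... | 𝐯′ , eq″ , len′ = subst (suc a ≤ℕ_) (sym len′) (s≤s (min 𝐯′
      (λ z → trans (eq″ z) (trans (eq′ _) (cong (to x) (swap-involutive i z))))))

  -- `exchange` shortens a minimal word of `x`. The result is minimal, since appending `i` turns any
  -- word of `x ∙ s i` into one of `x`.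
  length-descent : ∀ {x a} i → HasLength x a → Descent x i → ∃ λ b → a ≡ suc b × HasLength (x ∙ s i) b
  length-descent {x} {a} i ((𝐰 , eq , len) , min) desc
    with exchange 𝐰 i (descent-resp-≈ {x} {⟦ 𝐰 ⟧} i (λ z → sym (eq z)) desc)
  ... | 𝐯 , eq′ , len′ = length 𝐯 , a≡ , (𝐯 , (λ z → trans (eq′ z) (eq _)) , refl) , shortest
    where
    a≡ : a ≡ suc (length 𝐯)
    a≡ = trans (sym len) len′
    shortest : ∀ 𝐮 → ⟦ 𝐮 ⟧ ≈ x ∙ s i → length 𝐯 ≤ℕ length 𝐮
    shortest 𝐮 eq″ = ℕ.≤-pred (subst₂ _≤ℕ_ a≡ (length-∷ʳ 𝐮 i)
      (min (𝐮 ∷ʳ i) (λ z → trans (⟦∷ʳ⟧ 𝐮 i z) (trans (eq″ _) (cong (to x) (swap-involutive i z))))))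

  -- `HasLength` is a relation, so the existence of a length has to be carried along prefixes,
  -- starting from `length-e`.
  length-∙s : ∀ {x a} i → HasLength x a → ∃ (HasLength (x ∙ s i))
  length-∙s {x} {a} i hx with ascent⊎descent x i
  ... | inj₁ asc  = suc a , length-ascent {x} i hx asc
  ... | inj₂ desc = let b , _ , hxs = length-descent {x} i hx desc in b , hxs

  -- Bruhat order

  ≤-length : ∀ {x y a b} → x ≤ y → HasLength x a → HasLength y b → a ≤ℕ b
  ≤-length {x} ε hx hy = ℕ.≤-reflexive (length-unique {x} hx hy)
  ≤-length {x} (_◅_ {j = z} (inj₁ x≈z) z≤y) hx hy = ≤-length z≤y (length-resp-≈ {x} {z} x≈z hx) hy
  ≤-length {x} (inj₂ (_ , _ , _ , a′ , b′ , hx′ , hz , a′<b′) ◅ z≤y) hx hy =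
    ℕ.≤-trans (subst (_≤ℕ b′) (length-unique {x} hx′ hx) (ℕ.<⇒≤ a′<b′)) (≤-length z≤y hz hy)

  ≤-resp-≈ : ∀ {x y} x′ y′ → x ≤ y → x ≈ x′ → y ≈ y′ → x′ ≤ y′
  ≤-resp-≈ {x} {y} x′ y′ x≤y x≈x′ y≈y′ = x′≤x ◅◅ x≤y ◅◅ y≤y′
    where
    x′≤x : x′ ≤ x
    x′≤x = inj₁ (λ z → sym (x≈x′ z)) ◅ ε
    y≤y′ : y ≤ y′
    y≤y′ = inj₁ y≈y′ ◅ ε

  ascent⇒≤ : ∀ {x a} i → HasLength x a → Ascent x i → x ≤ x ∙ s i
  ascent⇒≤ {x} {a} i hx asc =
    inj₂ (s i , (e , i , (λ _ → refl)) , (λ _ → refl) , a , suc a , hx , length-ascent {x} i hx asc , ℕ.n<1+n a) ◅ ε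

  -- At a descent `x ∙ s i` is shorter than `x`, which `≤-length` excludes.
  ≤⇒ascent : ∀ {x a} i → HasLength x a → x ≤ x ∙ s i → Ascent x i
  ≤⇒ascent {x} i hx x≤xs with ascent⊎descent x i
  ... | inj₁ asc  = asc
  ... | inj₂ desc with length-descent {x} i hx desc
  ...   | b , refl , hxs = contradiction (≤-length x≤xs hx hxs) (ℕ.<⇒≱ (ℕ.n<1+n b))

  -- Distinguished subwords

  -- Stated for maps ℤ → ℤ rather than elements of W, so that products differing by
  -- factors e or by bracketing give convertible conditions.
  DistinguishedFrom : (ℤ → ℤ) → ∀ {𝐰} → Subword 𝐰 → Set
  DistinguishedFrom f []                     = ⊤
  DistinguishedFrom f (_∷_ {x = i} gen  𝐯) = DistinguishedFrom (f ∘ swap i) 𝐯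
  DistinguishedFrom f (_∷_ {x = i} unit 𝐯) = f (+ toℕ i) < f (+ suc (toℕ i)) × DistinguishedFrom f 𝐯

  -- Stated for all k, y and y′ up to ≈, since equal products in W carry different
  -- proofs and comparing these definitionally is costly.
  PrefixCondition : W → ∀ {𝐰} → Subword 𝐰 → Set
  PrefixCondition x {𝐰} 𝐯 = (j : Fin (length 𝐰)) (k : Fin n) (y y′ : W) → k ≡ lookup 𝐰 j →
    y ≈ x ∙ prefix 𝐯 (suc (toℕ j)) → y′ ≈ x ∙ prefix 𝐯 (toℕ j) ∙ s k → y ≤ y′

  distinguishedFrom-resp-≗ : ∀ {f g 𝐰} (𝐯 : Subword 𝐰) → f ≗ g → DistinguishedFrom f 𝐯 → DistinguishedFrom g 𝐯
  distinguishedFrom-resp-≗ []         f≗g _       = tt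
  distinguishedFrom-resp-≗ (gen  ∷ 𝐯) f≗g d       = distinguishedFrom-resp-≗ 𝐯 (λ z → f≗g _) d
  distinguishedFrom-resp-≗ (unit ∷ 𝐯) f≗g (a , d) = subst₂ _<_ (f≗g _) (f≗g _) a , distinguishedFrom-resp-≗ 𝐯 f≗g d

  -- Position `zero` yields the ascent at a `unit`; positions `suc j` form the condition for the
  -- tail, with `x` replaced by `x ∙ s i` after a `gen`.
  prefixCondition⇒distinguishedFrom : ∀ x {a 𝐰} → HasLength x a → (𝐯 : Subword 𝐰) →
                                      PrefixCondition x 𝐯 → DistinguishedFrom (to x) 𝐯
  prefixCondition⇒distinguishedFrom x hx [] _ = tt
  prefixCondition⇒distinguishedFrom x hx (_∷_ {x = i} gen 𝐯) cond =
    prefixCondition⇒distinguishedFrom (x ∙ s i) (proj₂ (length-∙s {x} i hx)) 𝐯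
      -- The eta-expansions compare the maps at `z`, where both bracketings agree definitionally.
      (λ j k y y′ k≡ y≈ y′≈ → cond (suc j) k y y′ k≡ (λ z → y≈ z) (λ z → y′≈ z))
  prefixCondition⇒distinguishedFrom x hx (_∷_ {x = i} unit 𝐯) cond =
    ≤⇒ascent {x} i hx (cond zero i _ _ refl (λ _ → refl) (λ _ → refl)) ,
    prefixCondition⇒distinguishedFrom x hx 𝐯
      (λ j k y y′ k≡ y≈ y′≈ → cond (suc j) k y y′ k≡ (λ z → y≈ z) (λ z → y′≈ z))

  distinguishedFrom⇒prefixCondition : ∀ x {a 𝐰} → HasLength x a → (𝐯 : Subword 𝐰) →
                                      DistinguishedFrom (to x) 𝐯 → PrefixCondition x 𝐯
  distinguishedFrom⇒prefixCondition x hx (gen ∷ 𝐯) d zero k y y′ refl y≈ y′≈ =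
    -- After `gen` both sides are the same product, so the condition is reflexivity.
    inj₁ (λ z → trans (y≈ z) (sym (y′≈ z))) ◅ ε
  distinguishedFrom⇒prefixCondition x hx (_∷_ {x = i} unit 𝐯) (asc , d) zero k y y′ refl y≈ y′≈ =
    ≤-resp-≈ y y′ (ascent⇒≤ {x} i hx asc) (λ z → sym (y≈ z)) (λ z → sym (y′≈ z))
  distinguishedFrom⇒prefixCondition x hx (_∷_ {x = i} gen 𝐯) d (suc j) k y y′ k≡ y≈ y′≈ =
    distinguishedFrom⇒prefixCondition (x ∙ s i) (proj₂ (length-∙s {x} i hx)) 𝐯 d j k y y′ k≡ (λ z → y≈ z) (λ z → y′≈ z)
  distinguishedFrom⇒prefixCondition x hx (unit ∷ 𝐯) (asc , d) (suc j) k y y′ k≡ y≈ y′≈ =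
    distinguishedFrom⇒prefixCondition x hx 𝐯 d j k y y′ k≡ (λ z → y≈ z) (λ z → y′≈ z)

  distinguished⇒ : ∀ {𝐰} (𝐯 : Subword 𝐰) → Distinguished 𝐯 → DistinguishedFrom (to e) 𝐯
  distinguished⇒ 𝐯 d = prefixCondition⇒distinguishedFrom e length-e 𝐯
    (λ j k y y′ → λ { refl y≈ y′≈ → ≤-resp-≈ y y′ (d j) (λ z → sym (y≈ z)) (λ z → sym (y′≈ z)) })

  distinguished⇐ : ∀ {𝐰} (𝐯 : Subword 𝐰) → DistinguishedFrom (to e) 𝐯 → Distinguished 𝐯
  distinguished⇐ 𝐯 d j = distinguishedFrom⇒prefixCondition e length-e 𝐯 d j _ _ _ refl (λ _ → refl) (λ _ → refl)

  -- Adjacent generators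

  -- For a, b = i, i+1 and p, q, r the values of `x` at i, i+1, i+2, the conditions `Ascent x a` and
  -- `Ascent x b` are p < q and q < r. Both sides of `exchanged` are p < r, those of `conjugate` are
  -- q < r, those of `conjugate⁻` are p < q; `compose` and `cancel` are transitivity. Isolating
  -- these facts lets one case analysis serve both directions.
  record Braided (a b : Fin n) : Set where
    field
      braid      : s a ∙ s b ∙ s a ≈ s b ∙ s a ∙ s b
      exchanged  : ∀ x → Ascent (x ∙ s a) b → Ascent (x ∙ s b) a
      conjugate  : ∀ x → Ascent (x ∙ s a ∙ s b) a → Ascent x b
      conjugate⁻ : ∀ x → Ascent x a → Ascent (x ∙ s b ∙ s a) b
      compose    : ∀ x → Ascent x a → Ascent x b → Ascent (x ∙ s a) b
      cancel     : ∀ x → Ascent (x ∙ s a) b → Ascent (x ∙ s a) a → Ascent x b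

  module Adjacent (i : Fin n) where
    a b : Fin n
    a = i
    b = next i

    P Q R : ℤ
    P = + toℕ i
    Q = + suc (toℕ i)
    R = + suc (suc (toℕ i))

    -- `next i` is i+1 reduced modulo n, so the witness is the quotient of i+1 by n.
    Q≋b : Q ≋ + toℕ b
    Q≋b = cong-mod (divides (+ q) (trans (cong (_- + toℕ b) Q≡) (cancelˡ (+ toℕ b) (+ q * + n))))
      where
      q = suc (toℕ i) / n
      Q≡ : Q ≡ + toℕ b + + q * + n
      Q≡ = trans (cong +_ (trans (m≡m%n+[m/n]*n (suc (toℕ i)) n)
                                 (cong (ℕ._+ q ℕ.* n) (sym (toℕ-fromℕ< (m%n<n (suc (toℕ i)) n))))))
                 (trans (ℤ.pos-+ (toℕ b) (q ℕ.* n)) (cong (_+_ (+ toℕ b)) (ℤ.pos-* q n)))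
      cancelˡ : ∀ c d → (c + d) - c ≡ d
      cancelˡ = solve-∀

    R≋1+b : R ≋ + suc (toℕ b)
    R≋1+b = ≋-suc Q≋b

    -- Subtracting i leaves the residues 0 and 2, which differ because n ≥ 3.
    P≋̸R : ¬ P ≋ R
    P≋̸R d with bounded-≋⇒≡ {0} {2} (ℕ.≤-trans (s≤s z≤n) 3≤n) 3≤n
                 (subst₂ _≋_ (ℤ.+-inverseʳ P) (cancelʳ P) (≋-+ (- P) d))
      where
      cancelʳ : ∀ c → (+ 2 + c) - c ≡ + 2
      cancelʳ = solve-∀
    ... | ()

    aP : swap a P ≡ Q
    aP = swap-bottom i

    aQ : swap a Q ≡ P
    aQ = swap-top i

    aR : swap a R ≡ R
    aR = swap-fixed i (P≋̸R ∘ ≋-sym) (a≋̸1+a Q ∘ ≋-sym)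

    bP : swap b P ≡ P
    bP = swap-fixed b (λ d → a≋̸1+a P (≋-trans d (≋-sym Q≋b))) (λ d → P≋̸R (≋-trans d (≋-sym R≋1+b)))

    bQ : swap b Q ≡ R
    bQ = trans (swap-low b Q≋b) (ℤ.+-comm Q 1ℤ)

    bR : swap b R ≡ Q
    bR = trans (cong (swap b) (sym bQ)) (swap-involutive b Q)

    -- Both sides exchange `P` and `R` and fix `Q`; by periodicity one representative of each class
    -- suffices.
    braid-ab : s a ∙ s b ∙ s a ≈ s b ∙ s a ∙ s b
    braid-ab z = go (z ≋? P) (z ≋? Q) (z ≋? R)
      where
      three : ∀ i j k {c d f g} → swap k c ≡ d → swap j d ≡ f → swap i f ≡ g → to (s i ∙ s j ∙ s k) c ≡ g
      three _ _ _ refl refl refl = refl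
      agree : ∀ {c} → to (s a ∙ s b ∙ s a) c ≡ to (s b ∙ s a ∙ s b) c → z ≋ c → to (s a ∙ s b ∙ s a) z ≡ to (s b ∙ s a ∙ s b) z
      agree = agree-≋ (s a ∙ s b ∙ s a) (s b ∙ s a ∙ s b)
      go : Dec (z ≋ P) → Dec (z ≋ Q) → Dec (z ≋ R) → to (s a ∙ s b ∙ s a) z ≡ to (s b ∙ s a ∙ s b) z
      go (yes d) _ _ = agree (trans (three a b a aP bQ aR) (sym (three b a b bP aP bQ))) d
      go (no _) (yes d) _ = agree (trans (three a b a aQ bP aP) (sym (three b a b bQ aR bR))) d
      go (no _) (no _) (yes d) = agree (trans (three a b a aR bR aQ) (sym (three b a b bR aQ bP))) d
      go (no ¬p) (no ¬q) (no ¬r) = trans (three a b a az bz az) (sym (three b a b bz az bz))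
        where
        az = swap-fixed a ¬p ¬q
        bz = swap-fixed b (λ d → ¬q (≋-trans d (≋-sym Q≋b))) (λ d → ¬r (≋-trans d (≋-sym R≋1+b)))

    rewrite-< : ∀ (x : W) {c c′ d d′} → c ≡ c′ → d ≡ d′ → to x c < to x d → to x c′ < to x d′
    rewrite-< x refl refl lt = lt

    ascent-b⇒ : ∀ x → Ascent x b → to x Q < to x R
    ascent-b⇒ x = consecutive-<-≋ x Q≋b

    ascent-b⇐ : ∀ x → to x Q < to x R → Ascent x b
    ascent-b⇐ x = consecutive-<-≋ x (≋-sym Q≋b)

    ascent-a-b⇒ : ∀ x → Ascent (x ∙ s a) b → to x P < to x R
    ascent-a-b⇒ x asc = rewrite-< x aQ aR (ascent-b⇒ (x ∙ s a) asc)

    ascent-a-b⇐ : ∀ x → to x P < to x R → Ascent (x ∙ s a) b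
    ascent-a-b⇐ x lt = ascent-b⇐ (x ∙ s a) (rewrite-< x (sym aQ) (sym aR) lt)

    ascent-b-a⇒ : ∀ x → Ascent (x ∙ s b) a → to x P < to x R
    ascent-b-a⇒ x = rewrite-< x bP bQ

    ascent-b-a⇐ : ∀ x → to x P < to x R → Ascent (x ∙ s b) a
    ascent-b-a⇐ x = rewrite-< x (sym bP) (sym bQ)

    abP : swap a (swap b P) ≡ Q
    abP = trans (cong (swap a) bP) aP

    abQ : swap a (swap b Q) ≡ R
    abQ = trans (cong (swap a) bQ) aR

    baQ : swap b (swap a Q) ≡ P
    baQ = trans (cong (swap b) aQ) bP

    baR : swap b (swap a R) ≡ Q
    baR = trans (cong (swap b) aR) bR

    braided-ab : Braided a b
    braided-ab = record
      { braid      = braid-ab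
      ; exchanged  = λ x asc → ascent-b-a⇐ x (ascent-a-b⇒ x asc)
      ; conjugate  = λ x asc → ascent-b⇐ x (rewrite-< x abP abQ asc)
      ; conjugate⁻ = λ x asc → ascent-b⇐ (x ∙ s b ∙ s a) (rewrite-< x (sym baQ) (sym baR) asc)
      ; compose    = λ x asc asc′ → ascent-a-b⇐ x (ℤ.<-trans asc (ascent-b⇒ x asc′))
      ; cancel     = λ x asc asc′ → ascent-b⇐ x (ℤ.<-trans (rewrite-< x aP aQ asc′) (ascent-a-b⇒ x asc))
      }

    braided-ba : Braided b a
    braided-ba = record
      { braid      = λ z → sym (braid-ab z)
      ; exchanged  = λ x asc → ascent-a-b⇐ x (ascent-b-a⇒ x asc)
      ; conjugate  = λ x asc → rewrite-< x baQ baR (ascent-b⇒ (x ∙ s b ∙ s a) asc)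
      ; conjugate⁻ = λ x asc → rewrite-< x (sym abP) (sym abQ) (ascent-b⇒ x asc)
      ; compose    = λ x asc asc′ → ascent-b-a⇐ x (ℤ.<-trans asc′ (ascent-b⇒ x asc))
      ; cancel     = λ x asc asc′ → ℤ.<-trans (ascent-b-a⇒ x asc)
                                      (rewrite-< x bQ bR (ascent-b⇒ (x ∙ s b) asc′))
      }

  -- Transferring subwords between words

  -- Stated for a single subword, because `flip` is invertible only on distinguished ones: it sends
  -- both `unit ∷ unit ∷ gen` and `gen ∷ unit ∷ unit` to `unit ∷ gen ∷ unit`.
  record Preserves (x : W) {𝐰 𝐮 : Word} (f : Subword 𝐰 → Subword 𝐮) (g : Subword 𝐮 → Subword 𝐰)
                   (𝐯 : Subword 𝐰) : Set where
    constructor preserves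
    field
      dist    : DistinguishedFrom (to x) (f 𝐯)
      value   : product (values (f 𝐯)) ≈ product (values 𝐯)
      count   : units (f 𝐯) ≡ units 𝐯
      inverts : g (f 𝐯) ≡ 𝐯

  -- For the case where `flip` does not reduce until `ascent?` is decided.
  preserves-by : ∀ {x 𝐰 𝐮} {f : Subword 𝐰 → Subword 𝐮} {g : Subword 𝐮 → Subword 𝐰} {𝐯 𝐯′} → f 𝐯 ≡ 𝐯′ →
                 DistinguishedFrom (to x) 𝐯′ → product (values 𝐯′) ≈ product (values 𝐯) →
                 units 𝐯′ ≡ units 𝐯 → g 𝐯′ ≡ 𝐯 → Preserves x f g 𝐯
  preserves-by refl = preserves

  -- Here `x` stands for the product of the entries before the two words; the maps may depend on it,
  -- as the choice in `flip` does.
  record Transfer (x : W) (𝐰 𝐮 : Word) : Set where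
    field
      fwd     : Subword 𝐰 → Subword 𝐮
      bwd     : Subword 𝐮 → Subword 𝐰
      fwd-ok  : ∀ 𝐯 → DistinguishedFrom (to x) 𝐯 → Preserves x fwd bwd 𝐯
      bwd-ok  : ∀ 𝐯 → DistinguishedFrom (to x) 𝐯 → Preserves x bwd fwd 𝐯

  ∷-map : ∀ k {𝐰 𝐮} → (W → Subword 𝐰 → Subword 𝐮) → W → Subword (k ∷ 𝐰) → Subword (k ∷ 𝐮)
  ∷-map k f x (gen  ∷ 𝐯) = gen  ∷ f (x ∙ s k) 𝐯
  ∷-map k f x (unit ∷ 𝐯) = unit ∷ f x 𝐯

  ∷-preserves : ∀ k {𝐰 𝐮} (f : W → Subword 𝐰 → Subword 𝐮) (g : W → Subword 𝐮 → Subword 𝐰) →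
                (∀ x 𝐯 → DistinguishedFrom (to x) 𝐯 → Preserves x (f x) (g x) 𝐯) →
                ∀ x 𝐯 → DistinguishedFrom (to x) 𝐯 → Preserves x (∷-map k f x) (∷-map k g x) 𝐯
  ∷-preserves k f g ok x (gen ∷ 𝐯) d with ok (x ∙ s k) 𝐯 d
  ... | preserves dist value count inverts =
    preserves dist (λ z → cong (swap k) (value z)) count (cong (gen ∷_) inverts)
  ∷-preserves k f g ok x (unit ∷ 𝐯) (asc , d) with ok x 𝐯 d
  ... | preserves dist value count inverts =
    preserves (asc , dist) (λ z → value z) (cong suc count) (cong (unit ∷_) inverts)

  ∷-transfer : ∀ k {𝐰 𝐮} → (∀ x → Transfer x 𝐰 𝐮) → ∀ x → Transfer x (k ∷ 𝐰) (k ∷ 𝐮)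
  ∷-transfer k t x = record
    { fwd    = ∷-map k f x
    ; bwd    = ∷-map k g x
    ; fwd-ok = ∷-preserves k f g (λ y → Transfer.fwd-ok (t y)) x
    ; bwd-ok = ∷-preserves k g f (λ y → Transfer.bwd-ok (t y)) x
    }
    where
    f = λ y → Transfer.fwd (t y)
    g = λ y → Transfer.bwd (t y)

  ++-transfer : ∀ 𝐩 {𝐰 𝐮} → (∀ x → Transfer x 𝐰 𝐮) → ∀ x → Transfer x (𝐩 ++ 𝐰) (𝐩 ++ 𝐮)
  ++-transfer []      t = t
  ++-transfer (k ∷ 𝐩) t = ∷-transfer k (++-transfer 𝐩 t)

  -- The bijection for a single braid move

  -- With x(i), x(i+1), x(i+2) = p, q, r and s_a, s_b = s_i, s_{i+1}, the product
  -- s_b arises from s_a s_b s_a with two e's only as e s_b e (p < q and p < r), but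
  -- from s_b s_a s_b both as e e s_b (p < q < r) and as s_b e e (p < r < q).
  flip : W → ∀ a b {𝐪} → Subword (a ∷ b ∷ a ∷ 𝐪) → Subword (b ∷ a ∷ b ∷ 𝐪)
  flip x a b (gen  ∷ gen  ∷ gen  ∷ 𝐯) = gen  ∷ gen  ∷ gen  ∷ 𝐯
  flip x a b (unit ∷ gen  ∷ gen  ∷ 𝐯) = gen  ∷ gen  ∷ unit ∷ 𝐯
  flip x a b (gen  ∷ gen  ∷ unit ∷ 𝐯) = unit ∷ gen  ∷ gen  ∷ 𝐯
  flip x a b (gen  ∷ unit ∷ gen  ∷ 𝐯) = gen  ∷ unit ∷ gen  ∷ 𝐯
  flip x a b (unit ∷ unit ∷ gen  ∷ 𝐯) = unit ∷ gen  ∷ unit ∷ 𝐯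
  flip x a b (gen  ∷ unit ∷ unit ∷ 𝐯) = unit ∷ gen  ∷ unit ∷ 𝐯
  flip x a b (unit ∷ gen  ∷ unit ∷ 𝐯) with ascent? x b
  ... | yes _ = unit ∷ unit ∷ gen  ∷ 𝐯
  ... | no  _ = gen  ∷ unit ∷ unit ∷ 𝐯
  flip x a b (unit ∷ unit ∷ unit ∷ 𝐯) = unit ∷ unit ∷ unit ∷ 𝐯

  flip-ascent : ∀ x a b {𝐪} (𝐯 : Subword 𝐪) → Ascent x b →
                flip x a b (unit ∷ gen ∷ unit ∷ 𝐯) ≡ unit ∷ unit ∷ gen ∷ 𝐯
  flip-ascent x a b 𝐯 asc with ascent? x b
  ... | yes _    = refl
  ... | no  ¬asc = contradiction asc ¬asc

  flip-descent : ∀ x a b {𝐪} (𝐯 : Subword 𝐪) → Descent x b →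
                 flip x a b (unit ∷ gen ∷ unit ∷ 𝐯) ≡ gen ∷ unit ∷ unit ∷ 𝐯
  flip-descent x a b 𝐯 desc with ascent? x b
  ... | yes asc = contradiction asc (ℤ.<-asym desc)
  ... | no  _   = refl

  -- The tail is untouched, and the three entries before it keep their product, so its condition
  -- carries over.
  flip-preserves : ∀ {a b} → Braided a b → ∀ {𝐪} x (𝐯 : Subword (a ∷ b ∷ a ∷ 𝐪)) →
                   DistinguishedFrom (to x) 𝐯 → Preserves x (flip x a b) (flip x b a) 𝐯
  flip-preserves B x (gen ∷ gen ∷ gen ∷ 𝐯) d =
    preserves (distinguishedFrom-resp-≗ 𝐯 (λ z → cong (to x) (Braided.braid B z)) d)
              (λ z → sym (Braided.braid B _)) refl refl
  flip-preserves B x (unit ∷ gen ∷ gen ∷ 𝐯) (p , d) =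
    preserves (Braided.conjugate⁻ B x p , d) (λ _ → refl) refl refl
  flip-preserves B x (gen ∷ gen ∷ unit ∷ 𝐯) (p , d) =
    preserves (Braided.conjugate B x p , d) (λ _ → refl) refl refl
  flip-preserves {a} {b} B x (gen ∷ unit ∷ gen ∷ 𝐯) (p , d) =
    preserves (Braided.exchanged B x p , distinguishedFrom-resp-≗ 𝐯 (λ z → cong (to x) (sym (squares z))) d)
              (λ z → squares _) refl refl
    where
    -- The outer letters cancel in both words, each square being the identity.
    squares : s b ∙ s b ≈ s a ∙ s a
    squares z = trans (swap-involutive b z) (sym (swap-involutive a z))
  flip-preserves {a} {b} B x (unit ∷ unit ∷ gen ∷ 𝐯) (p , q , d) =
    preserves (q , Braided.compose B x p q , d) (λ _ → refl) refl (flip-ascent x b a 𝐯 p)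
  flip-preserves {a} {b} B x (gen ∷ unit ∷ unit ∷ 𝐯) (p , q , d) =
    -- The last `unit` forces `Descent x a`, so the inverse `flip` returns to `gen ∷ unit ∷ unit`.
    -- In the preceding case the first `unit` forces `Ascent x a` and the other branch.
    preserves (Braided.cancel B x p q , p , d) (λ _ → refl) refl (flip-descent x b a 𝐯 (ascent-∙s⇒descent x a q))
  flip-preserves {a} {b} B x (unit ∷ gen ∷ unit ∷ 𝐯) (p , q , d) with ascent⊎descent x b
  ... | inj₁ asc  = preserves-by (flip-ascent x a b 𝐯 asc) (asc , p , d) (λ _ → refl) refl refl
  ... | inj₂ desc = preserves-by (flip-descent x a b 𝐯 desc) (q , descent⇒ascent-∙s x b desc , d) (λ _ → refl) refl refl
  flip-preserves B x (unit ∷ unit ∷ unit ∷ 𝐯) (p , q , _ , d) =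
    preserves (q , p , q , d) (λ _ → refl) refl refl

  braid-transfer : ∀ {a b} → Braided a b → Braided b a → ∀ 𝐪 x → Transfer x (a ∷ b ∷ a ∷ 𝐪) (b ∷ a ∷ b ∷ 𝐪)
  braid-transfer {a} {b} ab ba 𝐪 x = record
    { fwd    = flip x a b
    ; bwd    = flip x b a
    ; fwd-ok = flip-preserves ab x
    ; bwd-ok = flip-preserves ba x
    }

  braidMove-transfer : ∀ {𝐰 𝐮} → BraidMove 𝐰 𝐮 → ∀ x → Transfer x 𝐰 𝐮
  braidMove-transfer (lower 𝐩 i 𝐪) = ++-transfer 𝐩 (braid-transfer (Adjacent.braided-ba i) (Adjacent.braided-ab i) 𝐪)
  braidMove-transfer (raise 𝐩 i 𝐪) = ++-transfer 𝐩 (braid-transfer (Adjacent.braided-ab i) (Adjacent.braided-ba i) 𝐪)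

  -- Bijections between the sets `𝒜`

  𝒜-map : ∀ {r v 𝐰 𝐮} (f : Subword 𝐰 → Subword 𝐮) (g : Subword 𝐮 → Subword 𝐰) →
          (∀ 𝐯 → DistinguishedFrom (to e) 𝐯 → Preserves e f g 𝐯) → Setoid.Carrier (𝒜 r v 𝐰) → Setoid.Carrier (𝒜 r v 𝐮)
  𝒜-map f g ok (𝐯 , eq , d , us) = f 𝐯 , (λ z → trans (value z) (eq z)) , distinguished⇐ (f 𝐯) dist , trans count us
    where open Preserves (ok 𝐯 (distinguished⇒ 𝐯 d))

  transfer⇒inverse : ∀ {r v 𝐰 𝐮} → Transfer e 𝐰 𝐮 → Inverse (𝒜 r v 𝐰) (𝒜 r v 𝐮)
  transfer⇒inverse {r} {v} {𝐰} {𝐮} t = record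
    { to        = 𝒜-map {r} {v} fwd bwd fwd-ok
    ; from      = 𝒜-map {r} {v} bwd fwd bwd-ok
    ; to-cong   = cong fwd
    ; from-cong = cong bwd
    -- Round trips are identities only on distinguished subwords; membership in `𝒜` supplies this.
    ; inverse   = (λ { {𝐯 , _ , d , _} eq → trans (cong fwd eq) (Preserves.inverts (bwd-ok 𝐯 (distinguished⇒ 𝐯 d))) })
                , (λ { {𝐯 , _ , d , _} eq → trans (cong bwd eq) (Preserves.inverts (fwd-ok 𝐯 (distinguished⇒ 𝐯 d))) })
    }
    where open Transfer t

  𝒜-inverse : ∀ r v {𝐰 𝐮} → BraidConnected 𝐰 𝐮 → Inverse (𝒜 r v 𝐰) (𝒜 r v 𝐮)
  𝒜-inverse r v {𝐰} ε    = inverse-id (𝒜 r v 𝐰)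
  𝒜-inverse r v (m ◅ ms) = inverse (transfer⇒inverse {r} {v} (braidMove-transfer m e)) (𝒜-inverse r v ms)

lemma3p26 : (n : ℕ) (3≤n : 3 ≤ℕ n) → let open AffineWeyl n 3≤n in
    (w : W) (𝐰 𝐮 : Word) → ReducedWord w 𝐰 → ReducedWord w 𝐮 → BraidConnected 𝐰 𝐮 →
    (v : W) → v ≤ w → (r : ℕ) → Bijection (𝒜 r v 𝐰) (𝒜 r v 𝐮)
lemma3p26 n 3≤n w 𝐰 𝐮 _ _ connected v _ r = Inverse⇒Bijection (𝒜-inverse n 3≤n r v connected)
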